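{- Let $r$, $w$, and $t$ be positive integers with $t \geq r+w$. Let $t'$ be an integer with $0 \le t' \le t$ at which the function $x \mapsto \binom{x}{r}\binom{t-x}{w}$, defined on the integers $0 \le x \le t$, attains its maximum. If $d=\binom{t-r-w}{t'-r}$, then $$N((r,w;d),t)=bc_{d}(I_{t}(r,w))=bp_{d}(I_{t}(r,w))=\binom{t}{t'}.$$
   Context: Let $d,n,t,r,w$ be positive integers. A pair $(X,\mathcal B)$, where $X$ is a set of $n$ points and $\mathcal B=\{B_1,\ldots,B_t\}$ is a collection of $t$ subsets (blocks) of $X$, is an $(r,w;d)$-cover-free family with $t$ blocks if for any two sets of indices $L,M\subseteq\{1,\ldots,t\}$ with $L\cap M=\emptyset$, $|L|=r$, $|M|=w$, one has $\left|\left(\bigcap_{l\in L}B_l\right)\setminus\left(\bigcup_{m\in M}B_m\right)\right|\ge d$. $N((r,w;d),t)$ denotes the minimum number of points $|X|$ of an $(r,w;d)$-cover-free family having $t$ blocks. The bi-intersection graph $I_t(r,w)$ is the bipartite graph whose vertices are all $r$-subsets and all $w$-subsets of $\{1,\ldots,t\}$ (one part consisting of the $r$-subsets, the other of the $w$-subsets), where an $r$-subset is adjacent to a $w$-subset if and only if they are disjoint. A biclique of a graph $G$ is a complete bipartite subgraph of $G$. The $d$-biclique covering number $bc_d(G)$ (resp. $d$-biclique partition number $bp_d(G)$) is the minimum number of bicliques of $G$ such that every edge of $G$ belongs to at least $d$ (resp. exactly $d$) of these bicliques. Binomial coefficients $\binom{a}{b}$ are $0$ when $b<0$ or $b>a$.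 -}

module Defs where

open import Data.Bool.Base using (Bool; true; _∧_; _∨_)
open import Data.Empty using () renaming (⊥ to Absurd)
open import Data.Fin.Base using (Fin)
open import Data.Fin.Subset using (Subset; ∣_∣; ⋂; ⋃; _∩_; _─_; Empty)
open import Data.Fin.Subset.Properties using (_∈?_)
open import Data.Integer.Base using (ℤ; +_; -[1+_])
open import Data.List.Base using (List; allFin; filter; map)
open import Data.Nat.Base using (ℕ; _≤_)
open import Data.Nat.Combinatorics using (_C_)
open import Data.Product.Base using (Σ; _×_; _,_; ∃)
open import Data.Sum.Base using (_⊎_; inj₁; inj₂)
open import Data.Vec.Base using (tabulate)
open import Relation.Binary.PropositionalEquality using (_≡_)
open import Relation.Nullary.Negation.Core using (¬_)

IsMinimum : (ℕ → Set) → ℕ → Set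
IsMinimum P n = P n × (∀ m → P m → n ≤ m)

-- The lower index is an integer so that it may be a difference:
-- truncated subtraction would turn a negative index into 0, giving 1 instead of 0.
binom : ℕ → ℤ → ℕ
binom n (+ k)    = n C k
binom n -[1+ _ ] = 0

elements : ∀ {t} → Subset t → List (Fin t)
elements L = filter (_∈? L) (allFin _)

IsCoverFreeFamily : (r w d : ℕ) {n t : ℕ} → (Fin t → Subset n) → Set
IsCoverFreeFamily r w d {n} {t} B =
  (L M : Subset t) → Empty (L ∩ M) → ∣ L ∣ ≡ r → ∣ M ∣ ≡ w →
  d ≤ ∣ ⋂ (map B (elements L)) ─ ⋃ (map B (elements M)) ∣

-- IsN r w d t n  reads  N((r,w;d),t) = n.
IsN : (r w d t : ℕ) → ℕ → Set
IsN r w d t =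
  IsMinimum (λ n → Σ (Fin t → Subset n) (IsCoverFreeFamily r w d))

record Graph : Set₁ where
  field
    Vertex     : Set
    Adj        : Vertex → Vertex → Set
    symmetric  : ∀ {u v} → Adj u v → Adj v u
    irreflexive : ∀ {v} → ¬ Adj v v

-- A complete bipartite subgraph is determined by its two parts.  These are
-- Bool-valued so that the bicliques containing an edge can be counted.  A part
-- may be empty; such a biclique has no edges, so the minima are unaffected.
record Biclique (G : Graph) : Set where
  open Graph G
  field
    left right : Vertex → Bool
    disjoint   : ∀ v → left v ≡ true → right v ≡ true → Absurd
    complete   : ∀ u v → left u ≡ true → right v ≡ true → Adj u v

  -- Edges are unordered: {u , v} is an edge of the biclique in either orientation.
  hasEdge : Vertex → Vertex → Bool
  hasEdge u v = (left u ∧ right v) ∨ (left v ∧ right u)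

multiplicity : ∀ {G k} → (Fin k → Biclique G) → (u v : Graph.Vertex G) → ℕ
multiplicity b u v = ∣ tabulate (λ i → Biclique.hasEdge (b i) u v) ∣

IsBicliqueCover : ∀ G (d : ℕ) {k} → (Fin k → Biclique G) → Set
IsBicliqueCover G d b = ∀ u v → Graph.Adj G u v → d ≤ multiplicity b u v

IsBicliquePartition : ∀ G (d : ℕ) {k} → (Fin k → Biclique G) → Set
IsBicliquePartition G d b = ∀ u v → Graph.Adj G u v → multiplicity b u v ≡ d

-- IsBc d G k  reads  bc_d(G) = k,  and  IsBp d G k  reads  bp_d(G) = k.
-- Bicliques are counted with repetition.
IsBc IsBp : ℕ → Graph → ℕ → Set
IsBc d G = IsMinimum (λ k → Σ (Fin k → Biclique G) (IsBicliqueCover G d))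
IsBp d G = IsMinimum (λ k → Σ (Fin k → Biclique G) (IsBicliquePartition G d))

SubsetOfSize : (t k : ℕ) → Set
SubsetOfSize t k = ∃ λ (S : Subset t) → ∣ S ∣ ≡ k

-- The disjoint union keeps the two parts distinct even when r = w.
BiAdj : ∀ {t r w} (u v : SubsetOfSize t r ⊎ SubsetOfSize t w) → Set
BiAdj (inj₁ (L , _)) (inj₂ (M , _)) = Empty (L ∩ M)
BiAdj (inj₂ (M , _)) (inj₁ (L , _)) = Empty (L ∩ M)
BiAdj (inj₁ _)       (inj₁ _)       = Absurd
BiAdj (inj₂ _)       (inj₂ _)       = Absurd

biIntersectionGraph : (t r w : ℕ) → Graph
biIntersectionGraph t r w = record
  { Vertex      = SubsetOfSize t r ⊎ SubsetOfSize t w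
  ; Adj         = BiAdj
  ; symmetric   = λ {u} {v} → sym′ u v
  ; irreflexive = λ {v} → irr v
  }
  where
  sym′ : (u v : SubsetOfSize t r ⊎ SubsetOfSize t w) → BiAdj u v → BiAdj v u
  sym′ (inj₁ _) (inj₂ _) e = e
  sym′ (inj₂ _) (inj₁ _) e = e

  irr : (v : SubsetOfSize t r ⊎ SubsetOfSize t w) → ¬ BiAdj v v
  irr (inj₁ _) ()
  irr (inj₂ _) ()

{-# OPTIONS --safe #-}

-- A subset S of {1,…,t} gives the biclique with parts {L ⊆ S} and {M ⊆ ∁ S},
-- which has C(|S|,r) · C(t−|S|,w) edges, and every biclique lies in the one
-- given by the union of its r-subsets; so no biclique has more than
-- m = C(t′,r) · C(t−t′,w) edges.  The bicliques of the t′-subsets all have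
-- exactly m edges, and contain every edge exactly d times.  Any d-fold cover
-- thus contains the edges at least as often in total as these C(t,t′)
-- bicliques, so k · m ≥ C(t,t′) · m.
module Submission where

open import Defs
open import Data.Bool.Base using (Bool; true; false; _∧_; if_then_else_)
open import Data.Bool.Properties using (∨-comm; ∨-identityʳ)
import Data.Bool.Properties as Bool
open import Data.Fin.Base using (Fin; zero; suc)
open import Data.Fin.Subset using (Subset; inside; outside; ∣_∣; ⋂; ⋃; ∁; _∩_; _─_; _∈_; _∉_; _⊆_; Empty)
open import Data.Fin.Subset.Properties using (_∈?_; _⊆?_; ∈⊤; ∉⊥; x∈p∩q⁺; x∈p∩q⁻; x∈p∪q⁺; x∈p∪q⁻; x∉p⇒x∈∁p; x∈∁p⇒x∉p; p─q⊆p; x∈p∧x∉q⇒x∈p─q; ∣∁p∣≡n∸∣p∣; ∣p∣≤n; nonempty?)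
open import Data.Integer.Base using (_⊖_)
open import Data.Integer.Properties using ([1+m]⊖[1+n]≡m⊖n)
open import Data.List.Base using (List; []; _∷_; _++_; allFin; length; lookup; map; tabulate)
open import Data.List.Properties using (map-++; map-∘; map-tabulate; tabulate-lookup; length-++; length-map; length-tabulate)
open import Data.List.Membership.Propositional using (lose) renaming (_∈_ to _∈ₗ_)
open import Data.List.Membership.Propositional.Properties using (∈-filter⁺; ∈-filter⁻; ∈-allFin)
open import Data.List.Relation.Unary.Any using (Any; here; there; any?; satisfied)
open import Data.Nat.Base using (ℕ; zero; suc; _+_; _*_; _∸_; _≤_; _<_; z≤n; s≤s; >-nonZero)
open import Data.Nat.Combinatorics using (_C_; nCn≡1; nCk≡nC[n∸k]; nCk+nC[k+1]≡[n+1]C[k+1])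
open import Data.Nat.ListAction using (sum)
open import Data.Nat.ListAction.Properties using (sum-++)
open import Data.Nat.Properties
open import Data.Nat.Tactic.RingSolver using (solve-∀)
open import Data.Product.Base using (_×_; _,_; proj₁; proj₂; ∃; ∃₂)
open import Data.Sum.Base using (inj₁; inj₂)
open import Data.Vec.Base using (here; there) renaming ([] to []ᵥ; _∷_ to _∷ᵥ_; lookup to lookupᵥ; tabulate to tabulateᵥ)
open import Data.Vec.Properties using (lookup∘tabulate; tabulate∘lookup; tabulate-cong; []=⇒lookup; lookup⇒[]=)
open import Function.Base using (_∘_; id)
open import Function.Bundles using (mk⇔)
open import Relation.Binary.PropositionalEquality using (_≡_; _≗_; refl; sym; trans; cong; cong₂; subst; module ≡-Reasoning)
open import Relation.Nullary.Decidable using (Dec; does; yes; no; _×-dec_; dec-true; does-⇔)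
open import Relation.Nullary.Negation using (¬_; contradiction)

private
  variable
    A A′ : Set
    t r w k n d : ℕ

-- Finite sums

⟦_⟧ : Bool → ℕ
⟦ b ⟧ = if b then 1 else 0

∑ : List A → (A → ℕ) → ℕ
∑ xs f = sum (map f xs)

∑-++ : ∀ (xs ys : List A) f → ∑ (xs ++ ys) f ≡ ∑ xs f + ∑ ys f
∑-++ xs ys f = trans (cong sum (map-++ f xs ys)) (sum-++ (map f xs) (map f ys))

∑-map : ∀ (g : A → A′) xs f → ∑ (map g xs) f ≡ ∑ xs (f ∘ g)
∑-map g xs f = cong sum (sym (map-∘ xs))

∑-cong : ∀ (xs : List A) {f g} → f ≗ g → ∑ xs f ≡ ∑ xs g
∑-cong []       f≗g = refl
∑-cong (x ∷ xs) f≗g = cong₂ _+_ (f≗g x) (∑-cong xs f≗g)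

∑-mono-≤ : ∀ (xs : List A) {f g} → (∀ x → x ∈ₗ xs → f x ≤ g x) → ∑ xs f ≤ ∑ xs g
∑-mono-≤ []       f≤g = z≤n
∑-mono-≤ (x ∷ xs) f≤g = +-mono-≤ (f≤g x (here refl)) (∑-mono-≤ xs (λ y → f≤g y ∘ there))

∑-const : ∀ (xs : List A) c → ∑ xs (λ _ → c) ≡ length xs * c
∑-const []       c = refl
∑-const (x ∷ xs) c = cong (c +_) (∑-const xs c)

∑-zero : ∀ (xs : List A) → ∑ xs (λ _ → 0) ≡ 0
∑-zero xs = trans (∑-const xs 0) (*-zeroʳ (length xs))

∑-+ : ∀ (xs : List A) f g → ∑ xs (λ x → f x + g x) ≡ ∑ xs f + ∑ xs g
∑-+ []       f g = refl
∑-+ (x ∷ xs) f g = begin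
  f x + g x + ∑ xs (λ x → f x + g x) ≡⟨ cong (f x + g x +_) (∑-+ xs f g) ⟩
  f x + g x + (∑ xs f + ∑ xs g)      ≡⟨ interchange (f x) (g x) (∑ xs f) (∑ xs g) ⟩
  f x + ∑ xs f + (g x + ∑ xs g)      ∎
  where
  open ≡-Reasoning
  interchange : ∀ a b c d → a + b + (c + d) ≡ a + c + (b + d)
  interchange = solve-∀

∑-*ʳ : ∀ (xs : List A) f c → ∑ xs (λ x → f x * c) ≡ ∑ xs f * c
∑-*ʳ []       f c = refl
∑-*ʳ (x ∷ xs) f c = trans (cong (f x * c +_) (∑-*ʳ xs f c)) (sym (*-distribʳ-+ c (f x) (∑ xs f)))

∑-*ˡ : ∀ (xs : List A) c f → ∑ xs (λ x → c * f x) ≡ c * ∑ xs f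
∑-*ˡ xs c f = trans (∑-cong xs (λ x → *-comm c (f x))) (trans (∑-*ʳ xs f c) (*-comm (∑ xs f) c))

∑-swap : ∀ (xs : List A) (ys : List A′) (f : A → A′ → ℕ) →
         ∑ xs (λ x → ∑ ys (f x)) ≡ ∑ ys (λ y → ∑ xs (λ x → f x y))
∑-swap []       ys f = sym (∑-zero ys)
∑-swap (x ∷ xs) ys f = trans (cong (∑ ys (f x) +_) (∑-swap xs ys f))
                             (sym (∑-+ ys (f x) (λ y → ∑ xs (λ x → f x y))))

⟦∧⟧ : ∀ a b → ⟦ a ∧ b ⟧ ≡ ⟦ a ⟧ * ⟦ b ⟧
⟦∧⟧ true  b = sym (+-identityʳ ⟦ b ⟧)
⟦∧⟧ false b = refl

⟦⟧-mono : ∀ {a b} → (a ≡ true → b ≡ true) → ⟦ a ⟧ ≤ ⟦ b ⟧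
⟦⟧-mono {false}        a⇒b = z≤n
⟦⟧-mono {true} {true}  a⇒b = ≤-refl
⟦⟧-mono {true} {false} a⇒b with () ← a⇒b refl

∑-false : ∀ (xs : List A) {f : A → Bool} → (∀ x → f x ≡ false) → ∑ xs (⟦_⟧ ∘ f) ≡ 0
∑-false xs f≡false = trans (∑-cong xs (cong ⟦_⟧ ∘ f≡false)) (∑-zero xs)

-- `multiplicity` is defined as a cardinality; this puts it into a form in which the order of
-- summation can be exchanged.
∣tabulate∣ : ∀ (f : Fin n → Bool) → ∣ tabulateᵥ f ∣ ≡ ∑ (allFin n) (⟦_⟧ ∘ f)
-- The tail of `allFin (suc n)` is `tabulate suc` and not an `allFin`, so the induction runs over an
-- arbitrary `tabulate`.
∣tabulate∣ f = trans (lemma f) (cong sum (sym (map-tabulate id (⟦_⟧ ∘ f))))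
  where
  lemma : ∀ {n} (f : Fin n → Bool) → ∣ tabulateᵥ f ∣ ≡ sum (tabulate (⟦_⟧ ∘ f))
  lemma {zero}  f = refl
  lemma {suc n} f with f zero
  ... | true  = cong suc (lemma (f ∘ suc))
  ... | false = lemma (f ∘ suc)

-- Families of bicliques are indexed by positions, while enumerations are lists; this passes from
-- the former to the latter.
∑-lookup : ∀ (xs : List A) f → ∑ (allFin (length xs)) (f ∘ lookup xs) ≡ ∑ xs f
∑-lookup xs f = begin
  sum (map (f ∘ lookup xs) (allFin (length xs))) ≡⟨ cong sum (map-tabulate id (f ∘ lookup xs)) ⟩
  sum (tabulate (f ∘ lookup xs))                 ≡⟨ cong sum (map-tabulate (lookup xs) f) ⟨
  sum (map f (tabulate (lookup xs)))             ≡⟨ cong (sum ∘ map f) (tabulate-lookup xs) ⟩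
  sum (map f xs)                                 ∎
  where open ≡-Reasoning

-- Binomial coefficients

nC0≡1 : ∀ n → n C 0 ≡ 1
nC0≡1 n = trans (nCk≡nC[n∸k] {0} {n} z≤n) (nCn≡1 n)

k≤n⇒0<nCk : k ≤ n → 0 < n C k
k≤n⇒0<nCk {n = n} z≤n = ≤-reflexive (sym (nC0≡1 n))
k≤n⇒0<nCk {suc k} {suc n} (s≤s k≤n) = begin
  1                 ≤⟨ k≤n⇒0<nCk k≤n ⟩
  n C k             ≤⟨ m≤m+n (n C k) (n C suc k) ⟩
  n C k + n C suc k ≡⟨ nCk+nC[k+1]≡[n+1]C[k+1] n k ⟩
  suc n C suc k     ∎
  where open ≤-Reasoning

binom-[1+k]⊖[1+l] : ∀ n k l → binom n (suc k ⊖ suc l) ≡ binom n (k ⊖ l)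
binom-[1+k]⊖[1+l] n k l = cong (binom n) ([1+m]⊖[1+n]≡m⊖n k l)

-- Pascal's rule survives the extension by 0 to negative lower indices: at the indices -1 and 0 only
-- the second summand remains and both sides are 1, and further down every term vanishes.
binom-pascal : ∀ n k l → binom n (k ⊖ l) + binom n (suc k ⊖ l) ≡ binom (suc n) (suc k ⊖ l)
binom-pascal n k       zero          = nCk+nC[k+1]≡[n+1]C[k+1] n k
binom-pascal n zero    (suc zero)    = trans (nC0≡1 n) (sym (nC0≡1 (suc n)))
binom-pascal n zero    (suc (suc l)) = refl
binom-pascal n (suc k) (suc l)       = begin
  binom n (suc k ⊖ suc l) + binom n (suc (suc k) ⊖ suc l) ≡⟨ cong₂ _+_ (binom-[1+k]⊖[1+l] n k l) (binom-[1+k]⊖[1+l] n (suc k) l) ⟩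
  binom n (k ⊖ l) + binom n (suc k ⊖ l)                   ≡⟨ binom-pascal n k l ⟩
  binom (suc n) (suc k ⊖ l)                               ≡⟨ binom-[1+k]⊖[1+l] (suc n) (suc k) l ⟨
  binom (suc n) (suc (suc k) ⊖ suc l)                     ∎
  where open ≡-Reasoning

-- A lower index that is not positive gives 1 or 0 whatever the upper index is. Counts of sets of
-- size 0 can thus ignore how the induction changes the upper index.
binom-0⊖ : ∀ m n l → binom m (0 ⊖ l) ≡ binom n (0 ⊖ l)
binom-0⊖ m n zero    = trans (nC0≡1 m) (sym (nC0≡1 n))
binom-0⊖ m n (suc l) = refl

-- Enumeration of the subsets of a given size

_∷ᵢ : SubsetOfSize t k → SubsetOfSize (suc t) (suc k)
(S , p) ∷ᵢ = inside ∷ᵥ S , cong suc p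

_∷ₒ : SubsetOfSize t k → SubsetOfSize (suc t) k
(S , p) ∷ₒ = outside ∷ᵥ S , p

-- Branching on the first point mirrors Pascal's rule, which drives the counts over these lists.
subsetsOfSize : ∀ t k → List (SubsetOfSize t k)
subsetsOfSize zero    zero    = ([]ᵥ , refl) ∷ []
subsetsOfSize zero    (suc k) = []
subsetsOfSize (suc t) zero    = map _∷ₒ (subsetsOfSize t zero)
subsetsOfSize (suc t) (suc k) = map _∷ᵢ (subsetsOfSize t k) ++ map _∷ₒ (subsetsOfSize t (suc k))

∑-subsetsOfSize : ∀ t k (f : SubsetOfSize (suc t) (suc k) → ℕ) →
  ∑ (subsetsOfSize (suc t) (suc k)) f ≡
  ∑ (subsetsOfSize t k) (f ∘ _∷ᵢ) + ∑ (subsetsOfSize t (suc k)) (f ∘ _∷ₒ)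
∑-subsetsOfSize t k f =
  trans (∑-++ (map _∷ᵢ (subsetsOfSize t k)) (map _∷ₒ (subsetsOfSize t (suc k))) f)
        (cong₂ _+_ (∑-map _∷ᵢ (subsetsOfSize t k) f) (∑-map _∷ₒ (subsetsOfSize t (suc k)) f))

length-subsetsOfSize : ∀ t k → length (subsetsOfSize t k) ≡ t C k
length-subsetsOfSize zero    zero    = refl
length-subsetsOfSize zero    (suc k) = refl
length-subsetsOfSize (suc t) zero    = begin
  length (map _∷ₒ (subsetsOfSize t 0)) ≡⟨ length-map _∷ₒ (subsetsOfSize t 0) ⟩
  length (subsetsOfSize t 0)           ≡⟨ length-subsetsOfSize t 0 ⟩
  t C 0                                ≡⟨ nC0≡1 t ⟩
  1                                    ≡⟨ nC0≡1 (suc t) ⟨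
  suc t C 0                            ∎
  where open ≡-Reasoning
length-subsetsOfSize (suc t) (suc k) = begin
  length (map _∷ᵢ Is ++ map _∷ₒ Os)           ≡⟨ length-++ (map _∷ᵢ Is) ⟩
  length (map _∷ᵢ Is) + length (map _∷ₒ Os)   ≡⟨ cong₂ _+_ (length-map _∷ᵢ Is) (length-map _∷ₒ Os) ⟩
  length Is + length Os                       ≡⟨ cong₂ _+_ (length-subsetsOfSize t k) (length-subsetsOfSize t (suc k)) ⟩
  t C k + t C suc k                           ≡⟨ nCk+nC[k+1]≡[n+1]C[k+1] t k ⟩
  suc t C suc k                               ∎
  where
  open ≡-Reasoning
  Is = subsetsOfSize t k
  Os = subsetsOfSize t (suc k)

-- If the first point lies in `U`, the two branches add up by Pascal's rule; otherwise the branch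
-- that contains it contributes nothing.
count-⊆ : ∀ (U : Subset t) k →
  ∑ (subsetsOfSize t k) (λ S → ⟦ does (proj₁ S ⊆? U) ⟧) ≡ ∣ U ∣ C k
count-⊆ []ᵥ zero    = refl
count-⊆ []ᵥ (suc k) = refl
count-⊆ {suc t} (x ∷ᵥ U) zero = begin
  ∑ (map _∷ₒ (subsetsOfSize t 0)) _                        ≡⟨ ∑-map _∷ₒ (subsetsOfSize t 0) _ ⟩
  ∑ (subsetsOfSize t 0) (λ S → ⟦ does (proj₁ S ⊆? U) ⟧)    ≡⟨ count-⊆ U 0 ⟩
  ∣ U ∣ C 0                                                ≡⟨ nC0≡1 ∣ U ∣ ⟩
  1                                                        ≡⟨ nC0≡1 ∣ x ∷ᵥ U ∣ ⟨
  ∣ x ∷ᵥ U ∣ C 0                                           ∎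
  where open ≡-Reasoning
count-⊆ {suc t} (outside ∷ᵥ U) (suc k) =
  trans (∑-subsetsOfSize t k _) (cong₂ _+_ (∑-zero (subsetsOfSize t k)) (count-⊆ U (suc k)))
count-⊆ {suc t} (inside  ∷ᵥ U) (suc k) =
  trans (∑-subsetsOfSize t k _)
        (trans (cong₂ _+_ (count-⊆ U k) (count-⊆ U (suc k))) (nCk+nC[k+1]≡[n+1]C[k+1] ∣ U ∣ k))

-- Sets that contain one of two disjoint sets and avoid the other

Empty-tail : ∀ {x} {S : Subset t} → Empty (x ∷ᵥ S) → Empty S
Empty-tail ∅ (i , i∈S) = ∅ (suc i , there i∈S)

disjoint⇒∣L∣+∣M∣≤t : ∀ (L M : Subset t) → Empty (L ∩ M) → ∣ L ∣ + ∣ M ∣ ≤ t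
disjoint⇒∣L∣+∣M∣≤t []ᵥ            []ᵥ            ∅ = z≤n
disjoint⇒∣L∣+∣M∣≤t (inside  ∷ᵥ L) (inside  ∷ᵥ M) ∅ = contradiction (zero , here) ∅
disjoint⇒∣L∣+∣M∣≤t (inside  ∷ᵥ L) (outside ∷ᵥ M) ∅ = s≤s (disjoint⇒∣L∣+∣M∣≤t L M (Empty-tail ∅))
disjoint⇒∣L∣+∣M∣≤t (outside ∷ᵥ L) (inside  ∷ᵥ M) ∅ =
  ≤-trans (≤-reflexive (+-suc ∣ L ∣ ∣ M ∣)) (s≤s (disjoint⇒∣L∣+∣M∣≤t L M (Empty-tail ∅)))
disjoint⇒∣L∣+∣M∣≤t (outside ∷ᵥ L) (outside ∷ᵥ M) ∅ = m≤n⇒m≤1+n (disjoint⇒∣L∣+∣M∣≤t L M (Empty-tail ∅))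

separates : (L M S : Subset t) → Bool
separates L M S = does (L ⊆? S) ∧ does (M ⊆? ∁ S)

-- Such a set consists of `L` and of k - |L| further points outside both `L` and `M`. In the
-- induction the first point is forced in by `L`, forced out by `M`, or free, and the free case is
-- Pascal's rule.
count-separates : ∀ (L M : Subset t) k → Empty (L ∩ M) →
  ∑ (subsetsOfSize t k) (λ S → ⟦ separates L M (proj₁ S) ⟧) ≡
  binom (t ∸ (∣ L ∣ + ∣ M ∣)) (k ⊖ ∣ L ∣)
count-separates []ᵥ []ᵥ zero    ∅ = refl
count-separates []ᵥ []ᵥ (suc k) ∅ = refl
count-separates (inside ∷ᵥ L) (inside ∷ᵥ M) k ∅ = contradiction (zero , here) ∅
-- A set of size 0 misses the point that `L` demands, and the lower index is negative, so both sides
-- are 0.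
count-separates {suc t} (inside ∷ᵥ L) (outside ∷ᵥ M) zero ∅ =
  trans (∑-map _∷ₒ (subsetsOfSize t 0) _) (∑-zero (subsetsOfSize t 0))
count-separates {suc t} (inside ∷ᵥ L) (outside ∷ᵥ M) (suc k) ∅ = begin
  _                               ≡⟨ ∑-subsetsOfSize t k _ ⟩
  ∑ (subsetsOfSize t k) (λ S → ⟦ separates L M (proj₁ S) ⟧) + ∑ (subsetsOfSize t (suc k)) (λ _ → 0)
                                  ≡⟨ cong₂ _+_ (count-separates L M k (Empty-tail ∅)) (∑-zero (subsetsOfSize t (suc k))) ⟩
  binom _ (k ⊖ ∣ L ∣) + 0         ≡⟨ +-identityʳ _ ⟩
  binom _ (k ⊖ ∣ L ∣)             ≡⟨ binom-[1+k]⊖[1+l] _ k ∣ L ∣ ⟨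
  binom _ (suc k ⊖ suc ∣ L ∣)     ∎
  where open ≡-Reasoning
count-separates {suc t} (outside ∷ᵥ L) (inside ∷ᵥ M) zero ∅ =
  trans (∑-map _∷ₒ (subsetsOfSize t 0) _)
        (trans (count-separates L M 0 (Empty-tail ∅)) (binom-0⊖ _ _ ∣ L ∣))
count-separates {suc t} (outside ∷ᵥ L) (inside ∷ᵥ M) (suc k) ∅ = begin
  _                               ≡⟨ ∑-subsetsOfSize t k _ ⟩
  -- The sets through the first point meet `M`, so their branch is 0.
  _                               ≡⟨ cong₂ _+_ (∑-false (subsetsOfSize t k) (λ S → Bool.∧-zeroʳ (does (L ⊆? proj₁ S)))) (count-separates L M (suc k) (Empty-tail ∅)) ⟩
  binom (t ∸ (∣ L ∣ + ∣ M ∣)) (suc k ⊖ ∣ L ∣)           ≡⟨ cong (λ n → binom (suc t ∸ n) (suc k ⊖ ∣ L ∣)) (+-suc ∣ L ∣ ∣ M ∣) ⟨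
  binom (suc t ∸ (∣ L ∣ + suc ∣ M ∣)) (suc k ⊖ ∣ L ∣)   ∎
  where open ≡-Reasoning
count-separates {suc t} (outside ∷ᵥ L) (outside ∷ᵥ M) zero ∅ =
  trans (∑-map _∷ₒ (subsetsOfSize t 0) _)
        (trans (count-separates L M 0 (Empty-tail ∅)) (binom-0⊖ _ _ ∣ L ∣))
count-separates {suc t} (outside ∷ᵥ L) (outside ∷ᵥ M) (suc k) ∅ = begin
  _                                                     ≡⟨ ∑-subsetsOfSize t k _ ⟩
  _                                                     ≡⟨ cong₂ _+_ (count-separates L M k (Empty-tail ∅)) (count-separates L M (suc k) (Empty-tail ∅)) ⟩
  binom u (k ⊖ ∣ L ∣) + binom u (suc k ⊖ ∣ L ∣)         ≡⟨ binom-pascal u k ∣ L ∣ ⟩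
  -- Disjointness bounds |L| + |M| by t, so no truncation occurs and `suc` moves out of the
  -- subtraction.
  binom (suc u) (suc k ⊖ ∣ L ∣)                         ≡⟨ cong (λ n → binom n (suc k ⊖ ∣ L ∣)) (+-∸-assoc 1 (disjoint⇒∣L∣+∣M∣≤t L M (Empty-tail ∅))) ⟨
  binom (suc t ∸ (∣ L ∣ + ∣ M ∣)) (suc k ⊖ ∣ L ∣)       ∎
  where
  open ≡-Reasoning
  u = t ∸ (∣ L ∣ + ∣ M ∣)

-- Bicliques of the bi-intersection graph

does-true : (a? : Dec A) → does a? ≡ true → A
does-true (yes a) _ = a

module _ {G : Graph} (b : Biclique G) where
  open Graph G
  open Biclique b

  -- One continuation per orientation, so that nested uses run through all combinations of
  -- orientations of two edges.
  hasEdge-cases : ∀ {P : Set} {u v} → hasEdge u v ≡ true →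
    (left u ≡ true → right v ≡ true → P) → (left v ≡ true → right u ≡ true → P) → P
  hasEdge-cases {u = u} {v} e f g with left u | right v | left v | right u
  ... | true  | true  | _     | _    = f refl refl
  ... | true  | false | true  | true = g refl refl
  ... | false | _     | true  | true = g refl refl

  hasEdge⇒Adj : ∀ {u v} → hasEdge u v ≡ true → Adj u v
  hasEdge⇒Adj {u} {v} e = hasEdge-cases e (complete u v) (λ l r → symmetric (complete v u l r))

multiplicity-sym : ∀ {G} (b : Fin k → Biclique G) u v → multiplicity b u v ≡ multiplicity b v u
multiplicity-sym b u v = cong ∣_∣ (tabulate-cong (λ i → ∨-comm (left (b i) u ∧ right (b i) v) _))
  where open Biclique

module _ {t r w : ℕ} where

  private
    G = biIntersectionGraph t r w
    rs = subsetsOfSize t r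
    ws = subsetsOfSize t w
  open Biclique

  biclique : Subset t → Biclique G
  biclique S = record
    { left     = λ { (inj₁ (L , _)) → does (L ⊆? S) ; (inj₂ _) → false }
    ; right    = λ { (inj₁ _) → false ; (inj₂ (M , _)) → does (M ⊆? ∁ S) }
    ; disjoint = λ { (inj₁ _) _ () ; (inj₂ _) () _ }
    ; complete = λ { (inj₁ (L , _)) (inj₂ (M , _)) p q (i , i∈L∩M) →
                     let i∈L , i∈M = x∈p∩q⁻ L M i∈L∩M in
                     x∈∁p⇒x∉p (does-true (M ⊆? ∁ S) q i∈M) (does-true (L ⊆? S) p i∈L) }
    }

  -- The left part of `biclique S` has no w-subsets, so the reversed orientation in `hasEdge` is
  -- false.
  hasEdge-biclique : ∀ (S : Subset t) (L : SubsetOfSize t r) (M : SubsetOfSize t w) →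
    hasEdge (biclique S) (inj₁ L) (inj₂ M) ≡ separates (proj₁ L) (proj₁ M) S
  hasEdge-biclique S (L , _) (M , _) = ∨-identityʳ (separates L M S)

  -- The sum takes in intersecting pairs too, which contribute 0 by `hasEdge⇒Adj`; fixing the
  -- r-subset as first endpoint counts each edge once.
  edgeCount : Biclique G → ℕ
  edgeCount b = ∑ rs (λ L → ∑ ws (λ M → ⟦ hasEdge b (inj₁ L) (inj₂ M) ⟧))

  -- The conditions on `L` and on `M` are independent of each other, so the double sum factors.
  edgeCount-biclique : ∀ S → edgeCount (biclique S) ≡ (∣ S ∣ C r) * ((t ∸ ∣ S ∣) C w)
  edgeCount-biclique S = begin
    edgeCount (biclique S)                      ≡⟨ ∑-cong rs (λ L → ∑-cong ws (λ M → trans (cong ⟦_⟧ (hasEdge-biclique S L M)) (⟦∧⟧ (does (proj₁ L ⊆? S)) _))) ⟩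
    ∑ rs (λ L → ∑ ws (λ M → f L * g M))         ≡⟨ ∑-cong rs (λ L → ∑-*ˡ ws (f L) g) ⟩
    ∑ rs (λ L → f L * ∑ ws g)                   ≡⟨ ∑-*ʳ rs f (∑ ws g) ⟩
    ∑ rs f * ∑ ws g                             ≡⟨ cong₂ _*_ (count-⊆ S r) (count-⊆ (∁ S) w) ⟩
    (∣ S ∣ C r) * (∣ ∁ S ∣ C w)                 ≡⟨ cong (λ n → (∣ S ∣ C r) * (n C w)) (∣∁p∣≡n∸∣p∣ S) ⟩
    (∣ S ∣ C r) * ((t ∸ ∣ S ∣) C w)             ∎
    where
    open ≡-Reasoning
    f : SubsetOfSize t r → ℕ
    f L = ⟦ does (proj₁ L ⊆? S) ⟧
    g : SubsetOfSize t w → ℕ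
    g M = ⟦ does (proj₁ M ⊆? ∁ S) ⟧

  -- Enlarging a biclique to the biclique of a set

  module _ (b : Biclique G) where

    -- Either part may hold the r-subsets, but two edges of opposite orientation
    -- would make two r-subsets adjacent.
    edges-cross : ∀ {L L′ : SubsetOfSize t r} {M M′ : SubsetOfSize t w} →
      hasEdge b (inj₁ L) (inj₂ M) ≡ true → hasEdge b (inj₁ L′) (inj₂ M′) ≡ true →
      Empty (proj₁ L ∩ proj₁ M′)
    edges-cross {L} {L′} {M} {M′} e e′ = hasEdge-cases b {u = inj₁ L} {inj₂ M} e
      (λ l  r  → hasEdge-cases b {u = inj₁ L′} {inj₂ M′} e′
        (λ l′ r′ → complete b (inj₁ L) (inj₂ M′) l r′)
        (λ l′ r′ → contradiction (complete b (inj₁ L) (inj₁ L′) l r′) id))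
      (λ l  r  → hasEdge-cases b {u = inj₁ L′} {inj₂ M′} e′
        (λ l′ r′ → contradiction (complete b (inj₁ L′) (inj₁ L) l′ r) id)
        (λ l′ r′ → complete b (inj₂ M′) (inj₁ L) l′ r))

    private
      Witness : Fin t → SubsetOfSize t r → SubsetOfSize t w → Set
      Witness i L M = hasEdge b (inj₁ L) (inj₂ M) ≡ true × i ∈ proj₁ L

      inSupport? : ∀ i → Dec (Any (λ L → Any (Witness i L) ws) rs)
      inSupport? i = any? (λ L → any? (λ M →
        (hasEdge b (inj₁ L) (inj₂ M) Bool.≟ true) ×-dec (i ∈? proj₁ L)) ws) rs

    -- The union of the r-subsets that are endpoints of edges, not of those in a given part: either
    -- part may hold the r-subsets, and a part that faces an empty one is unconstrained.
    support : Subset t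
    support = tabulateᵥ (does ∘ inSupport?)

    ∈-support⁺ : ∀ {i L M} → L ∈ₗ rs → M ∈ₗ ws → Witness i L M → i ∈ support
    ∈-support⁺ {i} L∈ M∈ x = lookup⇒[]= i support
      (trans (lookup∘tabulate (does ∘ inSupport?) i)
             (dec-true (inSupport? i) (lose L∈ (lose M∈ x))))

    ∈-support⁻ : ∀ {i} → i ∈ support → ∃₂ (Witness i)
    ∈-support⁻ {i} i∈ =
      let _ , y = satisfied (does-true (inSupport? i)
                    (trans (sym (lookup∘tabulate (does ∘ inSupport?) i)) ([]=⇒lookup i∈)))
      in _ , satisfied y

    edgeCount-≤ : edgeCount b ≤ (∣ support ∣ C r) * ((t ∸ ∣ support ∣) C w)
    edgeCount-≤ = ≤-trans
      (∑-mono-≤ rs (λ L L∈ → ∑-mono-≤ ws (λ M M∈ → ⟦⟧-mono (inBiclique L L∈ M M∈))))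
      (≤-reflexive (edgeCount-biclique support))
      where
      inBiclique : ∀ L → L ∈ₗ rs → ∀ M → M ∈ₗ ws → hasEdge b (inj₁ L) (inj₂ M) ≡ true →
                   hasEdge (biclique support) (inj₁ L) (inj₂ M) ≡ true
      inBiclique L L∈ M M∈ e = trans (hasEdge-biclique support L M) (cong₂ _∧_
        (dec-true (proj₁ L ⊆? support) (λ i∈L → ∈-support⁺ L∈ M∈ (e , i∈L)))
        -- A point of `M` in the support would lie in the r-subset `L′` of some edge, but
        -- `edges-cross` makes `L′` disjoint from `M`.
        (dec-true (proj₁ M ⊆? ∁ support) (λ i∈M → x∉p⇒x∈∁p (λ i∈U →
          let L′ , M′ , e′ , i∈L′ = ∈-support⁻ i∈U in
          edges-cross {L′} {L} {M′} {M} e′ e (_ , x∈p∩q⁺ (i∈L′ , i∈M))))))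

  multiplicity≡∑ : ∀ (b : Fin k → Biclique G) u v →
    multiplicity b u v ≡ ∑ (allFin k) (λ i → ⟦ hasEdge (b i) u v ⟧)
  multiplicity≡∑ b u v = ∣tabulate∣ (λ i → hasEdge (b i) u v)

  -- Double counting of the incidences between edges and the bicliques that contain them.
  ∑-multiplicity : ∀ (b : Fin k → Biclique G) →
    ∑ rs (λ L → ∑ ws (λ M → multiplicity b (inj₁ L) (inj₂ M))) ≡ ∑ (allFin k) (edgeCount ∘ b)
  ∑-multiplicity {k} b = begin
    ∑ rs (λ L → ∑ ws (λ M → multiplicity b (inj₁ L) (inj₂ M)))
      ≡⟨ ∑-cong rs (λ L → ∑-cong ws (λ M → multiplicity≡∑ b (inj₁ L) (inj₂ M))) ⟩
    ∑ rs (λ L → ∑ ws (λ M → ∑ (allFin k) (λ i → e L M i)))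
      ≡⟨ ∑-cong rs (λ L → ∑-swap ws (allFin k) (e L)) ⟩
    ∑ rs (λ L → ∑ (allFin k) (λ i → ∑ ws (λ M → e L M i)))
      ≡⟨ ∑-swap rs (allFin k) (λ L i → ∑ ws (λ M → e L M i)) ⟩
    ∑ (allFin k) (edgeCount ∘ b) ∎
    where
    open ≡-Reasoning
    e : SubsetOfSize t r → SubsetOfSize t w → Fin k → ℕ
    e L M i = ⟦ hasEdge (b i) (inj₁ L) (inj₂ M) ⟧

  -- A cover is constrained only on adjacent pairs, while the sums run over all pairs; this settles
  -- the remaining ones.
  multiplicity-nonEdge : ∀ (b : Fin k → Biclique G) {u v} → ¬ Graph.Adj G u v → multiplicity b u v ≡ 0
  multiplicity-nonEdge {k} b {u} {v} ¬adj = n≤0⇒n≡0 (begin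
    multiplicity b u v                             ≡⟨ multiplicity≡∑ b u v ⟩
    ∑ (allFin k) (λ i → ⟦ hasEdge (b i) u v ⟧)     ≤⟨ ∑-mono-≤ (allFin k) (λ i _ → ⟦⟧-mono {b = false} (λ e → contradiction (hasEdge⇒Adj (b i) e) ¬adj)) ⟩
    ∑ (allFin k) (λ _ → 0)                         ≡⟨ ∑-zero (allFin k) ⟩
    0                                              ∎)
    where open ≤-Reasoning

-- Cover-free families

∈-⋂⁺ : ∀ (B : A → Subset n) xs {p} → (∀ {x} → x ∈ₗ xs → p ∈ B x) → p ∈ ⋂ (map B xs)
∈-⋂⁺ B []       h = ∈⊤
∈-⋂⁺ B (x ∷ xs) h = x∈p∩q⁺ (h (here refl) , ∈-⋂⁺ B xs (h ∘ there))

∈-⋂⁻ : ∀ (B : A → Subset n) xs {p} → p ∈ ⋂ (map B xs) → ∀ {x} → x ∈ₗ xs → p ∈ B x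
∈-⋂⁻ B (x ∷ xs) p∈ (here refl) = proj₁ (x∈p∩q⁻ (B x) _ p∈)
∈-⋂⁻ B (x ∷ xs) p∈ (there y∈)  = ∈-⋂⁻ B xs (proj₂ (x∈p∩q⁻ (B x) _ p∈)) y∈

∈-⋃⁺ : ∀ (B : A → Subset n) {xs p x} → x ∈ₗ xs → p ∈ B x → p ∈ ⋃ (map B xs)
∈-⋃⁺ B (here refl) p∈ = x∈p∪q⁺ (inj₁ p∈)
∈-⋃⁺ B (there x∈)  p∈ = x∈p∪q⁺ (inj₂ (∈-⋃⁺ B x∈ p∈))

∈-⋃⁻ : ∀ (B : A → Subset n) xs {p} → p ∈ ⋃ (map B xs) → ∃ λ x → x ∈ₗ xs × p ∈ B x
∈-⋃⁻ B []       p∈ = contradiction p∈ ∉⊥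
∈-⋃⁻ B (x ∷ xs) p∈ with x∈p∪q⁻ (B x) _ p∈
... | inj₁ p∈B = x , here refl , p∈B
... | inj₂ p∈⋃ = let y , y∈ , p∈B = ∈-⋃⁻ B xs p∈⋃ in y , there y∈ , p∈B

∈-elements⁺ : ∀ {L : Subset t} {i} → i ∈ L → i ∈ₗ elements L
∈-elements⁺ {L = L} {i} = ∈-filter⁺ (_∈? L) (∈-allFin i)

∈-elements⁻ : ∀ {L : Subset t} {i} → i ∈ₗ elements L → i ∈ L
∈-elements⁻ {L = L} i∈ = proj₂ (∈-filter⁻ (_∈? L) {xs = allFin _} i∈)

lookup≡does-∈? : ∀ (S : Subset n) p → lookupᵥ S p ≡ does (p ∈? S)
lookup≡does-∈? (inside  ∷ᵥ S) zero    = refl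
lookup≡does-∈? (outside ∷ᵥ S) zero    = refl
lookup≡does-∈? (_       ∷ᵥ S) (suc p) = lookup≡does-∈? S p

p─q-disjoint : ∀ (p q : Subset n) {x} → x ∈ p ─ q → x ∉ q
p─q-disjoint (_ ∷ᵥ p) (outside ∷ᵥ q) (there x∈) (there x∈q) = p─q-disjoint p q x∈ x∈q
p─q-disjoint (_ ∷ᵥ p) (inside  ∷ᵥ q) (there x∈) (there x∈q) = p─q-disjoint p q x∈ x∈q

-- The transpose of the incidence matrix: for each point, the set of indices of the blocks through
-- it.
dual : (Fin t → Subset n) → (Fin n → Subset t)
dual B p = tabulateᵥ (λ i → lookupᵥ (B i) p)

∈-dual : ∀ (B : Fin t → Subset n) {i p} → i ∈ B p → p ∈ dual B i
∈-dual B {i} {p} i∈ =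
  lookup⇒[]= p (dual B i) (trans (lookup∘tabulate (λ j → lookupᵥ (B j) i) p) ([]=⇒lookup i∈))

dual-involutive : ∀ (B : Fin t → Subset n) → dual (dual B) ≗ B
dual-involutive B i =
  trans (tabulate-cong (λ p → lookup∘tabulate (λ j → lookupᵥ (B j) p) i)) (tabulate∘lookup (B i))

∈-dual⁻ : ∀ (B : Fin t → Subset n) {i p} → p ∈ dual B i → i ∈ B p
∈-dual⁻ B {i} {p} p∈ = subst (i ∈_) (dual-involutive B p) (∈-dual (dual B) p∈)

module _ {t r w n : ℕ} (B : Fin t → Subset n) where

  dualBicliques : Fin n → Biclique (biIntersectionGraph t r w)
  dualBicliques = biclique ∘ dual B

  -- A point lies in all blocks of `L` and in none of `M` exactly when its dual set contains `L` and
  -- avoids `M`, that is, when its biclique has this edge. Both sides count points, so the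
  -- indicators are compared point by point.
  ∣⋂─⋃∣≡multiplicity : ∀ (L : SubsetOfSize t r) (M : SubsetOfSize t w) →
    ∣ ⋂ (map B (elements (proj₁ L))) ─ ⋃ (map B (elements (proj₁ M))) ∣ ≡
    multiplicity dualBicliques (inj₁ L) (inj₂ M)
  ∣⋂─⋃∣≡multiplicity 𝐋@(L , _) 𝐌@(M , _) = cong ∣_∣ (trans (sym (tabulate∘lookup (I ─ U)))
    (tabulate-cong (λ p → trans (lookup≡does-∈? (I ─ U) p)
      (trans (does-⇔ (mk⇔ to from) (p ∈? I ─ U) ((L ⊆? dual B p) ×-dec (M ⊆? ∁ (dual B p))))
             (sym (hasEdge-biclique (dual B p) 𝐋 𝐌))))))
    where
    I = ⋂ (map B (elements L))
    U = ⋃ (map B (elements M))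

    to : ∀ {p} → p ∈ I ─ U → L ⊆ dual B p × M ⊆ ∁ (dual B p)
    to p∈ = (λ i∈L → ∈-dual B (∈-⋂⁻ B (elements L) (p─q⊆p I U p∈) (∈-elements⁺ i∈L)))
          , (λ i∈M → x∉p⇒x∈∁p (λ i∈p →
               p─q-disjoint I U p∈ (∈-⋃⁺ B (∈-elements⁺ i∈M) (∈-dual⁻ B i∈p))))

    from : ∀ {p} → L ⊆ dual B p × M ⊆ ∁ (dual B p) → p ∈ I ─ U
    from (L⊆ , M⊆) = x∈p∧x∉q⇒x∈p─q
      (∈-⋂⁺ B (elements L) (λ i∈ → ∈-dual⁻ B (L⊆ (∈-elements⁻ i∈))))
      (λ p∈U → let i , i∈ , p∈B = ∈-⋃⁻ B (elements M) p∈U in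
               x∈∁p⇒x∉p (M⊆ (∈-elements⁻ i∈)) (∈-dual B p∈B))

-- Each point yields one biclique, so lower bounds for covers carry over to cover-free families.
coverFree⇒cover : ∀ (B : Fin t → Subset n) → IsCoverFreeFamily r w d B →
  IsBicliqueCover (biIntersectionGraph t r w) d (dualBicliques B)
coverFree⇒cover B cff (inj₁ 𝐋@(L , ∣L∣≡r)) (inj₂ 𝐌@(M , ∣M∣≡w)) ∅ =
  subst (_ ≤_) (∣⋂─⋃∣≡multiplicity B 𝐋 𝐌) (cff L M ∅ ∣L∣≡r ∣M∣≡w)
coverFree⇒cover B cff (inj₂ 𝐌@(M , ∣M∣≡w)) (inj₁ 𝐋@(L , ∣L∣≡r)) ∅ =
  subst (_ ≤_) (trans (∣⋂─⋃∣≡multiplicity B 𝐋 𝐌) (multiplicity-sym (dualBicliques B) (inj₁ 𝐋) (inj₂ 𝐌)))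
        (cff L M ∅ ∣L∣≡r ∣M∣≡w)

partition⇒coverFree : ∀ (B : Fin t → Subset n) →
  IsBicliquePartition (biIntersectionGraph t r w) d (dualBicliques B) → IsCoverFreeFamily r w d B
partition⇒coverFree B part L M ∅ ∣L∣≡r ∣M∣≡w = ≤-reflexive (sym
  (trans (∣⋂─⋃∣≡multiplicity B (L , ∣L∣≡r) (M , ∣M∣≡w)) (part (inj₁ (L , ∣L∣≡r)) (inj₂ (M , ∣M∣≡w)) ∅)))

partition⇒cover : ∀ {G} (b : Fin k → Biclique G) → IsBicliquePartition G d b → IsBicliqueCover G d b
partition⇒cover b part u v adj = ≤-reflexive (sym (part u v adj))

-- The family of all subsets of size t′

module _ (t r w t′ : ℕ) where

  private
    G = biIntersectionGraph t r w
    Ss = subsetsOfSize t t′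
    m = (t′ C r) * ((t ∸ t′) C w)

  -- The points are the t′-subsets, and block i consists of those that contain i.
  uniformBlocks : Fin t → Subset (length Ss)
  uniformBlocks = dual (proj₁ ∘ lookup Ss)

  -- Derived from the blocks, so that one family serves all three minima; `dual-involutive` recovers
  -- the t′-subsets.
  uniformBicliques : Fin (length Ss) → Biclique G
  uniformBicliques = dualBicliques uniformBlocks

  -- The bicliques that contain the edge are those of the t′-subsets separating `L` from `M`, which
  -- `count-separates` counts.
  multiplicity-uniform : ∀ (L : SubsetOfSize t r) (M : SubsetOfSize t w) → Empty (proj₁ L ∩ proj₁ M) →
    multiplicity uniformBicliques (inj₁ L) (inj₂ M) ≡ binom (t ∸ (r + w)) (t′ ⊖ r)
  multiplicity-uniform 𝐋@(L , refl) 𝐌@(M , refl) ∅ = begin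
    multiplicity uniformBicliques (inj₁ 𝐋) (inj₂ 𝐌)
      ≡⟨ multiplicity≡∑ uniformBicliques (inj₁ 𝐋) (inj₂ 𝐌) ⟩
    ∑ (allFin (length Ss)) (λ i → ⟦ Biclique.hasEdge (uniformBicliques i) (inj₁ 𝐋) (inj₂ 𝐌) ⟧)
      ≡⟨ ∑-cong (allFin (length Ss)) (λ i → cong ⟦_⟧ (trans (hasEdge-biclique (dual uniformBlocks i) 𝐋 𝐌)
           (cong (separates L M) (dual-involutive (proj₁ ∘ lookup Ss) i)))) ⟩
    ∑ (allFin (length Ss)) (λ i → ⟦ separates L M (proj₁ (lookup Ss i)) ⟧)
      ≡⟨ ∑-lookup Ss (λ S → ⟦ separates L M (proj₁ S) ⟧) ⟩
    ∑ Ss (λ S → ⟦ separates L M (proj₁ S) ⟧)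
      ≡⟨ count-separates L M t′ ∅ ⟩
    binom (t ∸ (r + w)) (t′ ⊖ r) ∎
    where open ≡-Reasoning

  uniform-partition : IsBicliquePartition G (binom (t ∸ (r + w)) (t′ ⊖ r)) uniformBicliques
  uniform-partition (inj₁ L) (inj₂ M) ∅ = multiplicity-uniform L M ∅
  uniform-partition (inj₂ M) (inj₁ L) ∅ =
    trans (multiplicity-sym uniformBicliques (inj₂ M) (inj₁ L)) (multiplicity-uniform L M ∅)

  edgeCount-uniform : ∀ i → edgeCount (uniformBicliques i) ≡ m
  edgeCount-uniform i = begin
    edgeCount (uniformBicliques i)   ≡⟨ cong (edgeCount ∘ biclique) (dual-involutive (proj₁ ∘ lookup Ss) i) ⟩
    edgeCount (biclique S)           ≡⟨ edgeCount-biclique S ⟩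
    (∣ S ∣ C r) * ((t ∸ ∣ S ∣) C w)  ≡⟨ cong (λ s → (s C r) * ((t ∸ s) C w)) (proj₂ (lookup Ss i)) ⟩
    m                                ∎
    where
    open ≡-Reasoning
    S = proj₁ (lookup Ss i)

  module _ (r+w≤t : r + w ≤ t) (maximal : ∀ x → x ≤ t → (x C r) * ((t ∸ x) C w) ≤ m) where

    -- Positivity lets `cover-≥` cancel `m`. It follows from maximality at x = r, where the product
    -- is C(r,r) · C(t-r,w) and w ≤ t-r.
    0<m : 0 < m
    0<m = ≤-trans
      (*-mono-≤ (k≤n⇒0<nCk {r} {r} ≤-refl)
                (k≤n⇒0<nCk {w} {t ∸ r} (m+n≤o⇒m≤o∸n w (subst (_≤ t) (+-comm r w) r+w≤t))))
      (maximal r (m+n≤o⇒m≤o r r+w≤t))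

    cover-≥ : ∀ (b : Fin k → Biclique G) → IsBicliqueCover G (binom (t ∸ (r + w)) (t′ ⊖ r)) b → length Ss ≤ k
    cover-≥ {k} b cover = *-cancelʳ-≤ (length Ss) k m {{>-nonZero 0<m}} (begin
      length Ss * m
        ≡⟨ cong (_* m) (length-tabulate {n = length Ss} id) ⟨
      length (allFin (length Ss)) * m
        ≡⟨ ∑-const (allFin (length Ss)) m ⟨
      ∑ (allFin (length Ss)) (λ _ → m)
        ≡⟨ ∑-cong (allFin (length Ss)) edgeCount-uniform ⟨
      ∑ (allFin (length Ss)) (edgeCount ∘ uniformBicliques)
        ≡⟨ ∑-multiplicity uniformBicliques ⟨
      ∑ rs (λ L → ∑ ws (λ M → multiplicity uniformBicliques (inj₁ L) (inj₂ M)))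
        -- On edges the uniform family has exactly the multiplicity that a cover must reach, and
        -- elsewhere it has 0.
        ≤⟨ ∑-mono-≤ rs (λ L _ → ∑-mono-≤ ws (λ M _ → uniform≤ L M)) ⟩
      ∑ rs (λ L → ∑ ws (λ M → multiplicity b (inj₁ L) (inj₂ M)))
        ≡⟨ ∑-multiplicity b ⟩
      ∑ (allFin k) (edgeCount ∘ b)
        -- Maximality is applied with x the size of the support of each biclique.
        ≤⟨ ∑-mono-≤ (allFin k) (λ i _ → ≤-trans (edgeCount-≤ (b i)) (maximal _ (∣p∣≤n (support (b i))))) ⟩
      ∑ (allFin k) (λ _ → m)
        ≡⟨ ∑-const (allFin k) m ⟩
      length (allFin k) * m
        ≡⟨ cong (_* m) (length-tabulate {n = k} id) ⟩
      k * m ∎)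
      where
      open ≤-Reasoning
      rs = subsetsOfSize t r
      ws = subsetsOfSize t w

      uniform≤ : ∀ L M → multiplicity uniformBicliques (inj₁ L) (inj₂ M) ≤ multiplicity b (inj₁ L) (inj₂ M)
      uniform≤ L M with nonempty? (proj₁ L ∩ proj₁ M)
      ... | no  ∅ = ≤-trans (≤-reflexive (multiplicity-uniform L M ∅)) (cover (inj₁ L) (inj₂ M) ∅)
      ... | yes L∩M≢∅ = ≤-trans
        (≤-reflexive (multiplicity-nonEdge uniformBicliques {inj₁ L} {inj₂ M} (contradiction L∩M≢∅))) z≤n

theorem1 : (r w t : ℕ) → 0 < r → 0 < w → 0 < t → r + w ≤ t →
    (t′ : ℕ) → t′ ≤ t →
    (∀ x → x ≤ t → (x C r) * ((t ∸ x) C w) ≤ (t′ C r) * ((t ∸ t′) C w)) →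
    (d : ℕ) → d ≡ binom (t ∸ (r + w)) (t′ ⊖ r) →
    IsN r w d t (t C t′)
    × IsBc d (biIntersectionGraph t r w) (t C t′)
    × IsBp d (biIntersectionGraph t r w) (t C t′)
theorem1 r w t _ _ _ r+w≤t t′ _ maximal d refl
  -- The claimed value becomes the number of indices of the uniform family.
  rewrite sym (length-subsetsOfSize t t′) =
    ((uniformBlocks t r w t′ , partition⇒coverFree (uniformBlocks t r w t′) part)
      , λ { _ (B , cff) → bound (dualBicliques B) (coverFree⇒cover B cff) })
  , ((bicliques , partition⇒cover bicliques part) , λ { _ (b , cover) → bound b cover })
  , ((bicliques , part) , λ { _ (b , part′) → bound b (partition⇒cover b part′) })
  where
  bicliques = uniformBicliques t r w t′
  part = uniform-partition t r w t′
  bound = λ {k} → cover-≥ t r w t′ r+w≤t maximal {k}
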